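{- For every finite connected graph $G=(V,E)$ (with $V \neq \emptyset$), the number $\min_{v \in V} f_d(G,v)$ equals the minimum cardinality of a closed set in $G$.
   Context: $\mathrm{dist}(u,v)$ denotes the length of a shortest path between $u$ and $v$ in $G$. Explorer-Director game on $G$ with starting vertex $v$: a token is initially at $v$ (so $v$ counts as visited). On each turn the Explorer names a distance $d$ such that at least one vertex of $G$ is at distance exactly $d$ from the token's current position, and then the Director moves the token to a vertex of their choice at distance exactly $d$ from the current position. The Explorer wants to maximize, and the Director to minimize, the number of distinct vertices visited by the token; play continues until the Explorer can no longer force the token onto an unvisited vertex. $f_d(G,v)$ is the number of visited vertices at the end of the game under optimal play by both players; equivalently, it is the largest $k$ such that the Explorer has a (possibly adaptive) strategy guaranteeing, against every play of the Director, that at least $k$ distinct vertices (including $v$) are visited after finitely many turns. Closed set: a non-empty subset $U \subseteq V$ is closed if for every $u \in U$ and every $v \in V$ there exists $x \in U$ with $\mathrm{dist}(u,v)=\mathrm{dist}(u,x)$, where distances are computed in $G$. -}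

module Defs where

open import Data.Fin.Base using (Fin)
open import Data.Fin.Properties using (_≟_; any?; all?)
open import Data.Fin.Subset using (Subset; _∈_; _∉_; _⊃_; _∪_; ⁅_⁆; ⊥; ∣_∣; Nonempty)
open import Data.Fin.Subset.Induction using (⊃-wellFounded)
open import Data.Fin.Subset.Properties
  using (_∈?_; ∉⊥; ∣p∣≤n; x∈⁅x⁆; x∈⁅y⁆⇒x≡y; p⊆p∪q; q⊆p∪q; x∈p∪q⁻; ⊆-antisym; ∪-assoc; ∪-identityˡ)
open import Data.Nat.Base using (ℕ; zero; suc; _≤_; z≤n; s≤s; s≤s⁻¹)
open import Data.Nat.Properties using (≤-trans; ≤∧≢⇒<; _≤?_) renaming (_≟_ to _≟ℕ_)
open import Data.Product.Base using (∃; ∃-syntax; Σ-syntax; _×_; _,_; proj₁; proj₂)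
open import Data.Sum.Base using (_⊎_; inj₁; inj₂; [_,_]′)
open import Data.Vec.Base using (Vec; []; _∷_; head; last)
open import Data.Vec.Relation.Unary.AllPairs using (allPairs?)
open import Data.Vec.Relation.Unary.Linked using (Linked; linked?)
open import Data.Vec.Relation.Unary.Unique.Propositional using (Unique)
open import Function.Base using (_∘_; id)
open import Induction.WellFounded using (Acc; acc)
open import Relation.Binary.Definitions using (Symmetric; Irreflexive)
  renaming (Decidable to Decidable₂)
open import Relation.Binary.PropositionalEquality using (_≡_; refl; sym; subst; cong)
open import Relation.Nullary.Decidable using (Dec; yes; no; map′; ¬?; _×-dec_; _⊎-dec_; _→-dec_)
open import Relation.Nullary.Negation using (¬_; contradiction)
open import Relation.Unary using (Decidable)

private
  variable
    n : ℕ

IsMinimum IsMaximum : (ℕ → Set) → ℕ → Set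
IsMinimum P m = P m × (∀ k → P k → m ≤ k)
IsMaximum P m = P m × (∀ k → P k → k ≤ m)

minimum : ∀ {P} → Decidable P → ∃ P → ∃ (IsMinimum P)
minimum {P} P? (k , p) = go k P? p
  where
  go : ∀ {P} k → Decidable P → P k → ∃ (IsMinimum P)
  go zero    P? p = zero , p , λ _ _ → z≤n
  go {P} (suc k) P? p with P? zero
  ... | yes p₀ = zero , p₀ , λ _ _ → z≤n
  ... | no ¬p₀ with go {P ∘ suc} k (P? ∘ suc) p
  ...   | m , q , least = suc m , q , λ where
            zero    p₀ → contradiction p₀ ¬p₀
            (suc j) r  → s≤s (least j r)

maximum : ∀ {P} → Decidable P → ∃ P → ∀ b → (∀ k → P k → k ≤ b) → ∃ (IsMaximum P)
maximum P? e b bound with P? b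
... | yes p = b , p , bound
maximum P? (k , p) zero bound | no ¬p with bound k p
... | z≤n = contradiction p ¬p
maximum {P} P? e (suc b) bound | no ¬p =
  maximum P? e b λ k q → s≤s⁻¹ (≤∧≢⇒< (bound k q) λ k≡b → ¬p (subst P k≡b q))

record Graph (n : ℕ) : Set₁ where
  field
    Adj         : Fin n → Fin n → Set
    adj?        : Decidable₂ Adj
    symmetric   : Symmetric Adj
    irreflexive : Irreflexive _≡_ Adj

  -- A path of length d visits d + 1 distinct vertices.
  IsPath : (u v : Fin n) {d : ℕ} → Vec (Fin n) (suc d) → Set
  IsPath u v p = head p ≡ u × last p ≡ v × Linked Adj p × Unique p

  PathOfLength : (u v : Fin n) → ℕ → Set
  PathOfLength u v d = Σ[ p ∈ Vec (Fin n) (suc d) ] IsPath u v p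

  Connected : Set
  Connected = ∀ u v → ∃ (PathOfLength u v)

private
  anyVec? : ∀ d {P : Vec (Fin n) d → Set} → Decidable P → Dec (∃ P)
  anyVec? zero    P? = map′ ([] ,_) (λ where ([] , p) → p) (P? [])
  anyVec? (suc d) P? =
    map′ (λ where (x , xs , p) → x ∷ xs , p) (λ where (x ∷ xs , p) → x , xs , p)
         (any? λ x → anyVec? d λ xs → P? (x ∷ xs))

record ConnectedGraph (n : ℕ) : Set₁ where
  field
    graph     : Graph n
    connected : Graph.Connected graph

  open Graph graph public

  pathOfLength? : ∀ u v → Decidable (PathOfLength u v)
  pathOfLength? u v d = anyVec? (suc d) λ p →
    (head p ≟ u) ×-dec (last p ≟ v) ×-dec linked? adj? p ×-dec
    allPairs? (λ x y → ¬? (x ≟ y)) p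

  shortest : ∀ u v → ∃ (IsMinimum (PathOfLength u v))
  shortest u v = minimum (pathOfLength? u v) (connected u v)

  dist : Fin n → Fin n → ℕ
  dist u v = proj₁ (shortest u v)

  dist-isMinimum : ∀ u v → IsMinimum (PathOfLength u v) (dist u v)
  dist-isMinimum u v = proj₂ (shortest u v)

module _ (G : ConnectedGraph n) where
  open ConnectedGraph G using (dist)

  Closed : Subset n → Set
  Closed U = Nonempty U × (∀ u → u ∈ U → ∀ v → ∃[ x ] x ∈ U × dist u v ≡ dist u x)

module _ (G : ConnectedGraph n) where
  open ConnectedGraph G

  -- An adaptive strategy of the Explorer for a token at u.  Being a
  -- well-founded tree, it ends after finitely many turns however the
  -- Director replies, and its subtrees may depend on the whole history.
  data Strategy (u : Fin n) : Set where
    stop : Strategy u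
    call : (d : ℕ) → ∃[ w ] dist u w ≡ d →
           (∀ w → dist u w ≡ d → Strategy w) → Strategy u

  -- The Director's replies to a strategy, up to the point where it stops.
  data Play {u : Fin n} : Strategy u → Set where
    stop  : Play stop
    reply : ∀ {d e next} (w : Fin n) (at-d : dist u w ≡ d) →
            Play (next w at-d) → Play (call d e next)

  visited : ∀ {u} {σ : Strategy u} → Play σ → Subset n
  visited {u} stop          = ⁅ u ⁆
  visited {u} (reply _ _ π) = ⁅ u ⁆ ∪ visited π

  CanGuarantee : Fin n → ℕ → Set
  CanGuarantee v k = Σ[ σ ∈ Strategy v ] ∀ (π : Play σ) → k ≤ ∣ visited π ∣

  -- The game tree is infinite, so that CanGuarantee has a largest k is shown
  -- constructively by deciding it on the finitely many states (S , u).
  module _ (k : ℕ) where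

    -- S holds the vertices visited before the token arrived at u.
    data Win (S : Subset n) (u : Fin n) : Set where
      done : k ≤ ∣ S ∪ ⁅ u ⁆ ∣ → Win S u
      turn : (v : Fin n) → (∀ w → dist u w ≡ dist u v → Win (S ∪ ⁅ u ⁆) w) → Win S u

    fromWin : ∀ {S u} → Win S u → Σ[ σ ∈ Strategy u ] ∀ (π : Play σ) → k ≤ ∣ S ∪ visited π ∣
    fromWin (done k≤) = stop , λ where stop → k≤
    fromWin {S} {u} (turn v f) =
      call (dist u v) (v , refl) (λ w e → proj₁ (fromWin (f w e))) , λ where
        (reply w e π) → subst (λ T → k ≤ ∣ T ∣) (∪-assoc S ⁅ u ⁆ (visited π)) (proj₂ (fromWin (f w e)) π)

    toWin : ∀ {S u} (σ : Strategy u) → (∀ (π : Play σ) → k ≤ ∣ S ∪ visited π ∣) → Win S u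
    toWin stop h = done (h stop)
    toWin {S} {u} (call _ (v , refl) next) h = turn v λ w e →
      toWin (next w e) λ π → subst (λ T → k ≤ ∣ T ∣) (sym (∪-assoc S ⁅ u ⁆ (visited π))) (h (reply w e π))

    -- If every state with more visited vertices is decided, then the states
    -- (S , u) with u ∉ S are decided by one unfolding, and those with
    -- u ∈ S by saturating the set T of positions already known to be won.
    module _ (S : Subset n) (rec : ∀ {S′} → S′ ⊃ S → Decidable (Win S′)) where

      unfold? : ∀ u → Decidable (Win (S ∪ ⁅ u ⁆)) → Dec (Win S u)
      unfold? u dec = map′ [ done , (λ (v , f) → turn v f) ]′
        (λ where (done p) → inj₁ p ; (turn v f) → inj₂ (v , f))
        ((k ≤? _) ⊎-dec any? λ v → all? λ w → (dist u w ≟ℕ dist u v) →-dec dec w)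

      fresh? : ∀ u → u ∉ S → Dec (Win S u)
      fresh? u u∉S = unfold? u (rec (p⊆p∪q ⁅ u ⁆ , u , q⊆p∪q S ⁅ u ⁆ (x∈⁅x⁆ u) , u∉S))

      absorb : ∀ {u} → u ∈ S → S ∪ ⁅ u ⁆ ≡ S
      absorb {u} u∈S = ⊆-antisym
        (λ x∈ → [ id , (λ x∈u → subst (_∈ S) (sym (x∈⁅y⁆⇒x≡y u x∈u)) u∈S) ]′ (x∈p∪q⁻ S ⁅ u ⁆ x∈))
        (p⊆p∪q ⁅ u ⁆)

      Known : Subset n → Fin n → Set
      Known T w = w ∈ T ⊎ (w ∉ S × Win S w)

      known? : ∀ T → Decidable (Known T)
      known? T w with w ∈? S
      ... | yes w∈S = map′ inj₁ [ id , (λ (w∉S , _) → contradiction w∈S w∉S) ]′ (w ∈? T)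
      ... | no  w∉S = (w ∈? T) ⊎-dec map′ (w∉S ,_) proj₂ (fresh? w w∉S)

      Step : Subset n → Fin n → Set
      Step T u = k ≤ ∣ S ∣ ⊎ ∃[ v ] ∀ w → dist u w ≡ dist u v → Known T w

      step? : ∀ T → Decidable (Step T)
      step? T u = (k ≤? ∣ S ∣) ⊎-dec
        any? λ v → all? λ w → (dist u w ≟ℕ dist u v) →-dec known? T w

      Sound : Subset n → Set
      Sound T = ∀ {u} → u ∈ T → Win S u

      step-sound : ∀ {T u} → Sound T → u ∈ S → Step T u → Win S u
      step-sound {u = u} snd u∈S (inj₁ k≤) = done (subst (λ X → k ≤ ∣ X ∣) (sym (absorb u∈S)) k≤)
      step-sound snd u∈S (inj₂ (v , f)) = turn v λ w e →
        subst (λ X → Win X w) (sym (absorb u∈S)) ([ snd , proj₂ ]′ (f w e))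

      Saturated : Subset n → Set
      Saturated T = ¬ (∃[ u ] u ∈ S × u ∉ T × Step T u)

      saturate : ∀ T → Acc _⊃_ T → Sound T → ∃[ T′ ] Sound T′ × Saturated T′
      saturate T (acc rs) snd with any? (λ u → (u ∈? S) ×-dec ¬? (u ∈? T) ×-dec step? T u)
      ... | no  sat = T , snd , sat
      ... | yes (u , u∈S , u∉T , st) = saturate (T ∪ ⁅ u ⁆)
        (rs (p⊆p∪q ⁅ u ⁆ , u , q⊆p∪q T ⁅ u ⁆ (x∈⁅x⁆ u) , u∉T))
        λ x∈ → [ snd , (λ x∈u → subst (Win S) (sym (x∈⁅y⁆⇒x≡y u x∈u)) (step-sound snd u∈S st)) ]′
                 (x∈p∪q⁻ T ⁅ u ⁆ x∈)

      complete : ∀ {T} → Saturated T → ∀ {X u} → X ≡ S → Win X u → Known T u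
      complete {T} sat {u = u} refl win with u ∈? S
      ... | no  u∉S = inj₂ (u∉S , win)
      ... | yes u∈S with u ∈? T
      ...   | yes u∈T = inj₁ u∈T
      complete {T} sat {u = u} refl (done k≤) | yes u∈S | no u∉T =
        contradiction (u , u∈S , u∉T , inj₁ (subst (λ X → k ≤ ∣ X ∣) (absorb u∈S) k≤)) sat
      complete {T} sat {u = u} refl (turn v f) | yes u∈S | no u∉T =
        contradiction (u , u∈S , u∉T , inj₂ (v , λ w e → complete sat (absorb u∈S) (f w e))) sat

      layer? : Decidable (Win S)
      layer? u with saturate ⊥ (⊃-wellFounded ⊥) (λ x∈⊥ → contradiction x∈⊥ ∉⊥)
      ... | T , snd , sat = map′ [ snd , proj₂ ]′ (complete sat refl) (known? T u)

    win? : ∀ S → Acc _⊃_ S → Decidable (Win S)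
    win? S (acc rs) = layer? S λ S′⊃S → win? _ (rs S′⊃S)

  canGuarantee? : ∀ v → Decidable (CanGuarantee v)
  canGuarantee? v k = map′
    (λ win → let σ , h = fromWin k win in σ , λ π → subst (λ T → k ≤ ∣ T ∣) (∪-identityˡ (visited π)) (h π))
    (λ (σ , h) → toWin k σ λ π → subst (λ T → k ≤ ∣ T ∣) (sym (∪-identityˡ (visited π))) (h π))
    (win? k ⊥ (⊃-wellFounded ⊥) v)

  play : ∀ {u} (σ : Strategy u) → Play σ
  play stop                     = stop
  play (call _ (w , at-d) next) = reply w at-d (play (next w at-d))

  optimum : ∀ v → ∃ (IsMaximum (CanGuarantee v))
  optimum v = maximum (canGuarantee? v) (0 , stop , λ _ → z≤n) n bound
    where
    bound : ∀ k → CanGuarantee v k → k ≤ n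
    bound k (σ , h) = ≤-trans (h (play σ)) (∣p∣≤n (visited (play σ)))

  f-d : Fin n → ℕ
  f-d v = proj₁ (optimum v)

  f-d-isMaximum : ∀ v → IsMaximum (CanGuarantee v) (f-d v)
  f-d-isMaximum v = proj₂ (optimum v)

{-# OPTIONS --safe #-}
-- The Director confines the token to a minimum closed set, once it starts there.
-- Conversely, suppose that with visited set S the Explorer cannot force m visited vertices, m
-- being the least size of a closed set, while they can from every larger visited set.
-- Then the losing positions all lie in S, and from a losing position the Director can
-- answer each distance by a losing position; so they form a closed set inside S, and |S| ≥ m already.
module Submission where

open import Defs
open import Data.Fin.Base using (Fin; zero)
open import Data.Fin.Properties using (any?; all?)
open import Data.Fin.Subset using (Subset; ∣_∣; _∈_; _∉_; _⊆_; _⊃_; _∪_; ⁅_⁆; ⊤; ⊥)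
open import Data.Fin.Subset.Induction using (⊃-wellFounded)
open import Data.Fin.Subset.Properties
  using (_∈?_; nonempty?; anySubset?; ∈⊤; x∈⁅x⁆; x∈⁅y⁆⇒x≡y; p⊆p∪q; q⊆p∪q; x∈p∪q⁻; p⊆q⇒∣p∣≤∣q∣; ∪-identityˡ)
open import Data.Nat.Base using (ℕ; suc; NonZero; _≤_)
open import Data.Nat.Properties using (≤-trans; ≤-antisym) renaming (_≟_ to _≟ℕ_)
open import Data.Product.Base using (∃-syntax; Σ-syntax; _×_; _,_; proj₁; proj₂)
open import Data.Sum.Base using ([_,_]′)
open import Data.Vec.Base using (tabulate)
open import Data.Vec.Properties using (lookup∘tabulate; []=⇒lookup; lookup⇒[]=)
open import Function.Base using (_∘_)
open import Induction.WellFounded using (Acc; acc)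
open import Relation.Binary.PropositionalEquality using (_≡_; refl; sym; trans; subst)
open import Relation.Nullary.Decidable
  using (yes; no; does; ¬?; _×-dec_; _→-dec_; dec-true; decidable-stable)
open import Relation.Unary using (Decidable)

private
  variable
    n : ℕ

module _ {P : Fin n → Set} (P? : Decidable P) where

  ⟦_⟧ : Subset n
  ⟦_⟧ = tabulate (does ∘ P?)

  ∈-⟦⟧⁺ : ∀ {x} → P x → x ∈ ⟦_⟧
  ∈-⟦⟧⁺ {x} px = lookup⇒[]= x ⟦_⟧ (trans (lookup∘tabulate (does ∘ P?) x) (dec-true (P? x) px))

  ∈-⟦⟧⁻ : ∀ {x} → x ∈ ⟦_⟧ → P x
  ∈-⟦⟧⁻ {x} x∈ with P? x | trans (sym (lookup∘tabulate (does ∘ P?) x)) ([]=⇒lookup x∈)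
  ... | yes px | _  = px
  -- Here `does (P? x)` has reduced, so the equation would identify `outside` with `inside`.
  ... | no  _  | ()

module _ (G : ConnectedGraph n) where
  open ConnectedGraph G using (dist)

  closed? : Decidable (Closed G)
  closed? U = nonempty? U ×-dec
    all? λ u → (u ∈? U) →-dec all? λ v → any? λ x → (x ∈? U) ×-dec (dist u v ≟ℕ dist u x)

  ClosedSize : ℕ → Set
  ClosedSize k = ∃[ U ] Closed G U × ∣ U ∣ ≡ k

  closedSize? : Decidable ClosedSize
  closedSize? k = anySubset? λ U → closed? U ×-dec (∣ U ∣ ≟ℕ k)

  ⊤-closed : Fin n → Closed G ⊤
  ⊤-closed u = (u , ∈⊤) , λ _ _ v → v , ∈⊤ , refl

  -- Whatever distance is called, closedness supplies a reply inside `U`; recursion on the strategy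
  -- tree strings these replies into a complete play.
  confine : ∀ {U} → Closed G U → ∀ {u} → u ∈ U → (σ : Strategy G u) →
            Σ[ π ∈ Play G σ ] visited G π ⊆ U
  confine {U} cl {u} u∈U stop = stop , λ x∈ → subst (_∈ U) (sym (x∈⁅y⁆⇒x≡y u x∈)) u∈U
  confine {U} cl {u} u∈U (call _ (v , refl) next) =
    let w , w∈U , e = proj₂ cl u u∈U v
        π , π⊆U     = confine cl w∈U (next w (sym e))
    in reply w (sym e) π , λ x∈ →
         [ (λ x∈u → subst (_∈ U) (sym (x∈⁅y⁆⇒x≡y u x∈u)) u∈U) , π⊆U ]′ (x∈p∪q⁻ ⁅ u ⁆ _ x∈)

  f-d≤∣closed∣ : ∀ {U} → Closed G U → ∀ {v} → v ∈ U → f-d G v ≤ ∣ U ∣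
  f-d≤∣closed∣ cl {v} v∈U =
    let σ , h   = proj₁ (f-d-isMaximum G v)
        π , π⊆U = confine cl v∈U σ
    in ≤-trans (h π) (p⊆q⇒∣p∣≤∣q∣ π⊆U)

  module _ {k : ℕ} (k≤closed : ∀ U → Closed G U → k ≤ ∣ U ∣) where

    module _ {S : Subset n} (rec : ∀ {S′} → S′ ⊃ S → ∀ u → Win G k S′ u) where

      -- Calling distance 0 records u as visited.
      win-fresh : ∀ {u} → u ∉ S → Win G k S u
      win-fresh {u} u∉S = turn u λ w _ →
        rec (p⊆p∪q ⁅ u ⁆ , u , q⊆p∪q S ⁅ u ⁆ (x∈⁅x⁆ u) , u∉S) w

      winning? : Decidable (Win G k S)
      winning? = win? G k S (⊃-wellFounded S)

      Losing : Subset n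
      Losing = ⟦ ¬? ∘ winning? ⟧

      Losing⊆S : Losing ⊆ S
      Losing⊆S {u} u∈L = decidable-stable (u ∈? S) (∈-⟦⟧⁻ (¬? ∘ winning?) u∈L ∘ win-fresh)

      -- If every reply at some distance were winning, calling that distance would win from `u`.
      -- Decidability turns this contradiction into an actual losing reply.
      losing-reply : ∀ {u} → u ∈ Losing → ∀ v → ∃[ x ] x ∈ Losing × dist u v ≡ dist u x
      losing-reply {u} u∈L v =
        decidable-stable (any? λ x → (x ∈? Losing) ×-dec (dist u v ≟ℕ dist u x)) λ ¬reply →
          ∈-⟦⟧⁻ (¬? ∘ winning?) u∈L (turn v λ w e →
            -- The token stands on a vertex of `S`, so the turn does not enlarge the visited set.
            subst (λ T → Win G k T w) (sym S∪u≡S)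
              (decidable-stable (winning? w) λ ¬win →
                ¬reply (w , ∈-⟦⟧⁺ (¬? ∘ winning?) ¬win , sym e)))
        where
        S∪u≡S : S ∪ ⁅ u ⁆ ≡ S
        S∪u≡S = absorb G k S (λ S′⊃S u → yes (rec S′⊃S u)) (Losing⊆S u∈L)

      -- One losing position makes `Losing` non-empty, hence closed. Then `S` has at least `k`
      -- elements and stopping at once wins, a contradiction.
      win-step : ∀ u → Win G k S u
      win-step u = decidable-stable (winning? u) λ ¬win →
        ¬win (done (≤-trans
          (k≤closed Losing ((u , ∈-⟦⟧⁺ (¬? ∘ winning?) ¬win) , λ _ → losing-reply))
          (p⊆q⇒∣p∣≤∣q∣ (p⊆p∪q ⁅ u ⁆ ∘ Losing⊆S))))

    -- Larger visited sets come first; the full set has no strict superset, so no separate base case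
    -- arises.
    win : ∀ {S} → Acc _⊃_ S → ∀ u → Win G k S u
    win (acc rs) = win-step λ S′⊃S → win (rs S′⊃S)

    ≤f-d : ∀ v → k ≤ f-d G v
    ≤f-d v =
      -- `Win` keeps the vertices visited before arrival, so the game opens with `⊥`.
      let σ , h = fromWin G k (win (⊃-wellFounded ⊥) v)
      in proj₂ (f-d-isMaximum G v) k
           (σ , λ π → subst (λ T → k ≤ ∣ T ∣) (∪-identityˡ (visited G π)) (h π))

  -- A start inside a smallest closed set attains the lower bound that holds for every start.
  closed-minimum⇒f-d-minimum : ∀ {m} → IsMinimum ClosedSize m → IsMinimum (λ k → ∃[ v ] f-d G v ≡ k) m
  closed-minimum⇒f-d-minimum {m} ((U , cl@((v , v∈U) , _) , ∣U∣≡m) , least) =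
    (v , ≤-antisym (subst (f-d G v ≤_) ∣U∣≡m (f-d≤∣closed∣ cl v∈U)) (lower v)) ,
    λ k (w , f-d≡k) → subst (m ≤_) f-d≡k (lower w)
    where
    lower : ∀ w → m ≤ f-d G w
    lower = ≤f-d λ U′ cl′ → least ∣ U′ ∣ (U′ , cl′ , refl)

theorem2p2 : ∀ (n : ℕ) .{{_ : NonZero n}} (G : ConnectedGraph n) →
    ∃[ m ] IsMinimum (λ k → ∃[ v ] f-d G v ≡ k) m
    × IsMinimum (λ k → ∃[ U ] Closed G U × ∣ U ∣ ≡ k) m
theorem2p2 (suc n) G =
  -- The search for the minimum starts from the whole vertex set, non-empty because it contains
  -- `zero`.
  let m , closed-min = minimum (closedSize? G) (∣ ⊤ {suc n} ∣ , ⊤ , ⊤-closed G zero , refl)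
  in m , closed-minimum⇒f-d-minimum G closed-min , closed-min
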